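{- $\mathfrak{cp}(\mathsf{meager}\setminus\{\emptyset\},\subseteq)=\operatorname{cof}(\mathsf{meager})$.
   Context: $\mathsf{meager}$ is the ideal of meager subsets of $2^\omega$, ordered by inclusion. For a poset $(P,\le)$, $F\subseteq P$ is a comparable family if for every $p\in P$ there is $q\in F$ with $p\le q$ or $q\le p$; $\mathfrak{cp}(P)$ is the minimal size of a comparable family. $\operatorname{cof}(\mathsf{meager})$ is the minimal size of a family $\mathcal{F}\subseteq\mathsf{meager}$ such that every meager set is contained in some member of $\mathcal{F}$. -}

module Defs where

open import Level using (Level; 0ℓ; _⊔_; suc)
open import Data.Bool using (Bool)
open import Data.Nat using (ℕ; _<_)
open import Data.Product using (Σ; ∃; ∃-syntax; Σ-syntax; _×_; proj₁)
open import Data.Sum using (_⊎_)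
open import Function.Bundles using (Func; Injection; Bijection)
open import Relation.Binary.Bundles using (Setoid; Poset)
open import Relation.Binary.Core using (REL)
open import Relation.Binary.Definitions using (_Respects_)
open import Relation.Binary.PropositionalEquality using (_≡_; _≗_)
import Relation.Binary.Construct.On as On
open import Relation.Nullary using (¬_)
open import Relation.Unary using (Pred; _⊆_; _≐_; ∅; ⋃; Empty)
open import Relation.Unary.Relation.Binary.Subset using (⊆-poset)

private
  variable
    a b c ℓ ℓ₁ ℓ₂ p r : Level

-- Choice as in ZFC. Sets with their equality are setoids, so the relation is
-- extensional and the choice function has to respect the equalities; without
-- the latter requirement the principle would be provable, as ∃ is a Σ-type.
AxiomOfChoice : ∀ a ℓ₁ b ℓ₂ r → Set (suc (a ⊔ ℓ₁ ⊔ b ⊔ ℓ₂ ⊔ r))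
AxiomOfChoice a ℓ₁ b ℓ₂ r =
  (A : Setoid a ℓ₁) (B : Setoid b ℓ₂) →
  let module A = Setoid A; module B = Setoid B in
  (R : REL A.Carrier B.Carrier r) →
  (∀ {x x′ y y′} → x A.≈ x′ → y B.≈ y′ → R x y → R x′ y′) →
  (∀ x → ∃[ y ] R x y) →
  Σ[ f ∈ Func A B ] (∀ x → R x (Func.to f x))

-- Cardinals are represented by setoids, compared by injections and bijections
-- that respect the equalities.

module _ (P : Poset c ℓ₁ ℓ₂) where
  open Poset P

  Family : Set (suc (c ⊔ ℓ₁ ⊔ ℓ₂))
  Family = Pred Carrier (c ⊔ ℓ₁ ⊔ ℓ₂)

  -- Members are compared in P only: the proof of membership is irrelevant.
  ∣_∣ : Family → Setoid (c ⊔ ℓ₁ ⊔ ℓ₂) ℓ₁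
  ∣ F ∣ = On.setoid {B = Σ Carrier F} Eq.setoid proj₁

  IsComparable : Family → Set (c ⊔ ℓ₁ ⊔ ℓ₂)
  IsComparable F = ∀ p → ∃[ q ] F q × (p ≤ q ⊎ q ≤ p)

  IsCofinal : Family → Set (c ⊔ ℓ₁ ⊔ ℓ₂)
  IsCofinal F = ∀ p → ∃[ q ] F q × p ≤ q

  IsMinimalSize : (Family → Set p) → Setoid a ℓ →
                  Set (suc (c ⊔ ℓ₁ ⊔ ℓ₂) ⊔ p ⊔ a ⊔ ℓ)
  IsMinimalSize Q κ =
    (∃[ F ] Q F × Bijection κ ∣ F ∣) × (∀ F → Q F → Injection κ ∣ F ∣)

  Is-𝔠𝔭 : Setoid a ℓ → Set (suc (c ⊔ ℓ₁ ⊔ ℓ₂) ⊔ a ⊔ ℓ)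
  Is-𝔠𝔭 = IsMinimalSize IsComparable

  Is-cof : Setoid a ℓ → Set (suc (c ⊔ ℓ₁ ⊔ ℓ₂) ⊔ a ⊔ ℓ)
  Is-cof = IsMinimalSize IsCofinal

2^ω : Set
2^ω = ℕ → Bool

-- Points of 2^ω are equal when pointwise equal, and subsets respect this.
PointSet : Set₁
PointSet = Σ[ A ∈ Pred 2^ω 0ℓ ] A Respects _≗_

-- The sets { y | y ≈[ n ] x } are the basic open neighbourhoods of x in the
-- product topology.
_≈[_]_ : 2^ω → ℕ → 2^ω → Set
y ≈[ n ] x = ∀ i → i < n → y i ≡ x i

Closure : Pred 2^ω 0ℓ → Pred 2^ω 0ℓ
Closure A x = ∀ n → ∃[ y ] y ≈[ n ] x × A y

Interior : Pred 2^ω 0ℓ → Pred 2^ω 0ℓ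
Interior A x = ∃[ n ] (∀ y → y ≈[ n ] x → A y)

NowhereDense : Pred 2^ω 0ℓ → Set
NowhereDense A = Empty (Interior (Closure A))

IsMeager : PointSet → Set₁
IsMeager A = Σ[ N ∈ (ℕ → PointSet) ]
  (∀ n → NowhereDense (proj₁ (N n))) × proj₁ A ≐ ⋃[ n ∶ ℕ ] proj₁ (N n)

IsNonempty : PointSet → Set
IsNonempty A = ¬ (proj₁ A ≐ ∅)

-- The sets satisfying Q, ordered by inclusion.
subsetPoset : (PointSet → Set₁) → Poset (suc 0ℓ) 0ℓ 0ℓ
subsetPoset Q = On.poset {B = Σ PointSet Q} (⊆-poset 2^ω 0ℓ) (λ A → proj₁ (proj₁ A))

meager : Poset (suc 0ℓ) 0ℓ 0ℓ
meager = subsetPoset IsMeager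

meager∖∅ : Poset (suc 0ℓ) 0ℓ 0ℓ
meager∖∅ = subsetPoset (λ A → IsMeager A × IsNonempty A)

{-# OPTIONS --safe #-}
-- Since cofinal families are comparable, only cof(meager) ≤ 𝔠𝔭 needs an idea.
-- Write 2^ω as 2^ω × 2^ω by interleaving, pick a point x_q in each member q of
-- a comparable family F, and let Y be the complement of the set of second
-- coordinates of the x_q. For meager A the meager set A × Y contains no x_q,
-- so it contains no member of F, so it lies below some q ∈ F.
-- If Y is not meager, then q* = { x | {x} × Y ⊆ q } is meager by Kuratowski and
-- Ulam, and it contains A; so the sets q* are cofinal.
-- If Y is meager, then 2^ω injects into its complement, so |F| is at least the
-- continuum, and the meager F_σ sets are cofinal and coded by points of 2^ω.
-- That cardinals have minima at all is Hönig's argument: a maximal set of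
-- selectors of (Aᵢ) with injective projections projects onto some Aᵢ.
module Submission where

open import Defs
open import Level using (Level; 0ℓ; suc; _⊔_; Lift)
open import Axiom.ExcludedMiddle using (ExcludedMiddle)
open import Data.Bool using (Bool; true; false; not; if_then_else_)
open import Data.Bool.Properties using (not-¬)
open import Data.Nat as ℕ
  using (ℕ; zero; _+_; _*_; _<_; _≤_; s<s; s≤s; z≤n; _≤′_; ≤′-refl; ≤′-step)
open import Data.Nat.Properties
open import Data.Product using (Σ; ∃; ∃₂; ∃-syntax; Σ-syntax; _×_; _,_; proj₁; proj₂)
open import Data.Sum using (_⊎_; inj₁; inj₂)
open import Data.Unit using (⊤)
open import Function.Base using (_∘_; id)
open import Function.Bundles using (Func; Injection; Bijection)
import Function.Construct.Composition as Composition
import Function.Construct.Identity as Identity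
open import Relation.Binary.Bundles using (Setoid; Poset)
import Relation.Binary.Construct.On as On
open import Relation.Binary.Core using (REL)
open import Relation.Binary.Definitions using (_Respects_)
open import Relation.Binary.PropositionalEquality
open import Relation.Nullary using (¬_; Dec; yes; no; contradiction; does)
open import Relation.Nullary.Decidable
  using (True; toWitness; fromWitness; decidable-stable; dec-true; dec-false)
open import Relation.Unary using (Pred; _⊆_; _≐_; ⋃)
open import Relation.Unary.Relation.Binary.Subset using (⊆-poset)

private
  variable
    a ℓ ι x : Level
    k m n : ℕ
    u v w : 2^ω

-- Basic neighbourhoods

≈-refl : u ≈[ n ] u
≈-refl _ _ = refl

≈-sym : u ≈[ n ] v → v ≈[ n ] u
≈-sym p j j<n = sym (p j j<n)

≈-trans : u ≈[ n ] v → v ≈[ n ] w → u ≈[ n ] w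
≈-trans p q j j<n = trans (p j j<n) (q j j<n)

≈-anti : m ≤ n → u ≈[ n ] v → u ≈[ m ] v
≈-anti m≤n p j j<m = p j (<-≤-trans j<m m≤n)

≗⇒≈ : u ≗ v → u ≈[ n ] v
≗⇒≈ p j _ = p j

≗-sym : u ≗ v → v ≗ u
≗-sym p j = sym (p j)

put : 2^ω × ℕ → Bool → 2^ω
put (u , k) b j = if does (j ≟ k) then b else u j

put-≈ : ∀ u k b → put (u , k) b ≈[ k ] u
put-≈ u k b j j<k rewrite dec-false (j ≟ k) (<⇒≢ j<k) = refl

put-at : ∀ u k b → put (u , k) b k ≡ b
put-at u k b rewrite dec-true (k ≟ k) refl = refl

-- Interleaving

-- The arguments swap roles at every step, so `odds-⊕` is an instance of `evens-⊕`.
_⊕_ : 2^ω → 2^ω → 2^ω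
(u ⊕ v) zero        = u zero
(u ⊕ v) (ℕ.suc j) = (v ⊕ (u ∘ ℕ.suc)) j

evens odds : 2^ω → 2^ω
evens w j = w (j * 2)
odds  w j = w (ℕ.suc (j * 2))

evens-⊕ : ∀ u v → evens (u ⊕ v) ≗ u
evens-⊕ u v zero      = refl
evens-⊕ u v (ℕ.suc j) = evens-⊕ (u ∘ ℕ.suc) (v ∘ ℕ.suc) j

odds-⊕ : ∀ u v → odds (u ⊕ v) ≗ v
odds-⊕ u v = evens-⊕ v (u ∘ ℕ.suc)

⊕-η : ∀ w → evens w ⊕ odds w ≗ w
⊕-η w zero                = refl
⊕-η w (ℕ.suc zero)        = refl
⊕-η w (ℕ.suc (ℕ.suc j)) = ⊕-η (w ∘ ℕ.suc ∘ ℕ.suc) j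

⊕-cong-≈ : ∀ {u u′ v v′} → u ≈[ k ] u′ → v ≈[ k ] v′ → (u ⊕ v) ≈[ k ] (u′ ⊕ v′)
⊕-cong-≈ p q zero      0<k                 = p 0 0<k
⊕-cong-≈ {k = ℕ.suc k} p q (ℕ.suc j) (s<s j<k) =
  ⊕-cong-≈ {k = k} (≈-anti (n≤1+n k) q) (λ l l<k → p (ℕ.suc l) (s<s l<k)) j j<k

⊕-cong : ∀ {u u′ v v′} → u ≗ u′ → v ≗ v′ → u ⊕ v ≗ u′ ⊕ v′
⊕-cong p q j = ⊕-cong-≈ (≗⇒≈ p) (≗⇒≈ q) j (n<1+n j)

odds-≈ : u ≈[ k * 2 ] v → odds u ≈[ k ] odds v
odds-≈ p j j<k = p _ (*-monoˡ-≤ 2 j<k)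

evens-≈ : u ≈[ k * 2 ] v → evens u ≈[ k ] evens v
evens-≈ p j j<k = p _ (<⇒≤ (*-monoˡ-≤ 2 j<k))

-- A countable base

step-pair : ℕ × ℕ → ℕ × ℕ
step-pair (m , zero)    = zero , ℕ.suc m
step-pair (m , ℕ.suc n) = ℕ.suc m , n

unpair : ℕ → ℕ × ℕ
unpair zero      = zero , zero
unpair (ℕ.suc j) = step-pair (unpair j)

unpair-surjective : ∀ m n → ∃[ j ] unpair j ≡ (m , n)
unpair-surjective m n = diagonal (m + n) m n refl
  where
  diagonal : ∀ s m n → m + n ≡ s → ∃[ j ] unpair j ≡ (m , n)
  diagonal zero      zero      zero      _  = 0 , refl
  diagonal (ℕ.suc s) zero      (ℕ.suc n) eq =
    let j , e = diagonal s n zero (trans (+-identityʳ n) (suc-injective eq))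
    in ℕ.suc j , cong step-pair e
  diagonal s         (ℕ.suc m) n         eq =
    let j , e = diagonal s m (ℕ.suc n) (trans (+-suc m n) eq)
    in ℕ.suc j , cong step-pair e

digit : ℕ → Bool
digit zero      = false
digit (ℕ.suc _) = true

digit-surjective : ∀ b → ∃[ j ] digit j ≡ b
digit-surjective false = 0 , refl
digit-surjective true  = 1 , refl

prefix : ℕ → ℕ → 2^ω
prefix zero      c _         = false
prefix (ℕ.suc k) c zero      = digit (proj₁ (unpair c))
prefix (ℕ.suc k) c (ℕ.suc j) = prefix k (proj₂ (unpair c)) j

prefix-surjective : ∀ k u → ∃[ c ] prefix k c ≈[ k ] u
prefix-surjective zero      u = 0 , λ _ ()
prefix-surjective (ℕ.suc k) u =
  let b , p = digit-surjective (u 0)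
      d , q = prefix-surjective k (u ∘ ℕ.suc)
      c , e = unpair-surjective b d
  in c , λ where
    zero      _         → trans (cong (digit ∘ proj₁) e) p
    (ℕ.suc j) (s<s j<k) → trans (cong (λ z → prefix k (proj₂ z) j) e) (q j j<k)

radius : ℕ → ℕ
radius m = proj₁ (unpair m)

centre : ℕ → 2^ω
centre m = prefix (radius m) (proj₂ (unpair m))

Ball : ℕ → Pred 2^ω 0ℓ
Ball m w = w ≈[ radius m ] centre m

ball : ∀ u k → ∃[ m ] radius m ≡ k × centre m ≈[ k ] u
ball u k =
  let c , p = prefix-surjective k u
      m , e = unpair-surjective k c
  in m , cong proj₁ e , λ j j<k →
       trans (cong (λ z → prefix (proj₁ z) (proj₂ z) j) e) (p j j<k)

-- Nowhere dense and meager sets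

-- The positive form of nowhere density: it hands the constructions below an actual ball that misses
-- `N`.
Avoidable : Pred 2^ω 0ℓ → Set
Avoidable N = ∀ u k → ∃[ v ] v ≈[ k ] u × ∃[ l ] (∀ w → w ≈[ l ] v → ¬ N w)

avoidable⇒nowhereDense : ∀ {N} → Avoidable N → NowhereDense N
avoidable⇒nowhereDense avoid u (k , dense) =
  let v , v≈u , l , ¬N   = avoid u k
      w , w≈v , Nw       = dense v v≈u l
  in ¬N w w≈v Nw

nowhereDense-⊆ : ∀ {M N} → M ⊆ N → NowhereDense N → NowhereDense M
nowhereDense-⊆ M⊆N nwd u (k , dense) = nwd u (k , λ v v≈u l →
  let w , w≈v , Mw = dense v v≈u l in w , w≈v , M⊆N Mw)

-- `IsMeager` asks for an exact union; cutting each `N n` down to `A` turns a cover into one.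
coveredMeager : (A : PointSet) (N : ℕ → PointSet) →
                (∀ n → NowhereDense (proj₁ (N n))) →
                proj₁ A ⊆ ⋃[ n ∶ ℕ ] proj₁ (N n) → IsMeager A
coveredMeager (A , A-resp) N nwd A⊆N =
  (λ n → (λ u → A u × proj₁ (N n) u) ,
         λ eq (Au , Nu) → A-resp eq Au , proj₂ (N n) eq Nu) ,
  (λ n → nowhereDense-⊆ proj₂ (nwd n)) ,
  (λ Au → let n , Nu = A⊆N Au in n , Au , Nu) ,
  (λ (_ , Au , _) → Au)

evens⁻¹-avoidable : ∀ {N} → Avoidable N → Avoidable (N ∘ evens)
evens⁻¹-avoidable avoid u k =
  let v , v≈ , l , ¬N = avoid (evens u) k in
  v ⊕ odds u ,
  ≈-trans (⊕-cong-≈ v≈ ≈-refl) (≗⇒≈ (⊕-η u)) ,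
  l * 2 ,
  λ w w≈ → ¬N (evens w) (≈-trans (evens-≈ w≈) (≗⇒≈ (evens-⊕ v (odds u))))

singleton : 2^ω → PointSet
singleton u = (_≗ u) , λ v≗w v≗u j → trans (sym (v≗w j)) (v≗u j)

singleton-avoidable : ∀ u → Avoidable (_≗ u)
singleton-avoidable u v k =
  put (v , k) (not (u k)) , put-≈ v k _ , ℕ.suc k , λ w w≈ w≗u →
    not-¬ (w≗u k) (trans (w≈ k (n<1+n k)) (put-at v k (not (u k))))

singleton-meager : ∀ u → IsMeager (singleton u)
singleton-meager u = coveredMeager (singleton u) (λ _ → singleton u)
  (λ _ → avoidable⇒nowhereDense (singleton-avoidable u)) (0 ,_)

-- A section of N that is not nowhere dense is dense in some ball of the base, so
-- Kuratowski–Ulam comes down to these countably many sets being nowhere dense.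
DenseSection : Pred 2^ω 0ℓ → ℕ → Pred 2^ω 0ℓ
DenseSection N m u = ∀ v → Ball m v → Closure (λ w → N (u ⊕ w)) v

-- A box around `(u , centre m)` contains a smaller box missing `N`. For `w` in its first side, the
-- section of `N` at `w` misses the second side, an open part of `Ball m`, so it is not dense there.
denseSection-avoidable : ∀ {N} m → Avoidable N → Avoidable (DenseSection N m)
denseSection-avoidable {N} m avoid u k =
  let r                = radius m
      -- Each coordinate inherits `k + r` digits: at least `k` for the first, at least `r` for the
      -- second.
      z , z≈ , l , ¬N  = avoid (u ⊕ centre m) ((k + r) * 2)
      evens-z≈u        = ≈-trans (evens-≈ {k = k + r} z≈) (≗⇒≈ (evens-⊕ u (centre m)))
      odds-z≈c         = ≈-trans (odds-≈ {k = k + r} z≈) (≗⇒≈ (odds-⊕ u (centre m)))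
  in
  evens z , ≈-anti (m≤m+n k r) evens-z≈u , l , λ w w≈ dense →
    let y , y≈ , Nwy = dense (odds z) (≈-anti (m≤n+m r k) odds-z≈c) l
    in ¬N (w ⊕ y) (≈-trans (⊕-cong-≈ w≈ y≈) (≗⇒≈ (⊕-η z))) Nwy

-- A copy of 2^ω avoiding countably many nowhere dense sets

module Fusion (N : ℕ → Pred 2^ω 0ℓ) (avoid : ∀ n → Avoidable (N n)) where

  -- Step n writes the digit z n at a position that depends on earlier digits
  -- only, before avoiding N n; this makes the digits recoverable from the limit.
  State : Set
  State = 2^ω × ℕ

  step : ℕ → State → Bool → State
  step n (u , k) b =
    -- The new length protects both the written digit `k` and the `l` digits that keep the limit out
    -- of `N n`.
    let v , _ , l , _ = avoid n (put (u , k) b) (ℕ.suc k) in v , ℕ.suc k + l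

  state : 2^ω → ℕ → State
  state z zero      = (λ _ → false) , 0
  state z (ℕ.suc n) = step n (state z n) (z n)

  point : 2^ω → ℕ → 2^ω
  point z n = proj₁ (state z n)

  length : 2^ω → ℕ → ℕ
  length z n = proj₂ (state z n)

  length-< : ∀ z n → length z n < length z (ℕ.suc n)
  length-< z n = m≤m+n (ℕ.suc (length z n)) _

  n≤length : ∀ z n → n ≤ length z n
  n≤length z zero      = z≤n
  n≤length z (ℕ.suc n) = ≤-trans (s≤s (n≤length z n)) (length-< z n)

  point-step : ∀ z n → point z (ℕ.suc n) ≈[ ℕ.suc (length z n) ] put (state z n) (z n)
  point-step z n =
    proj₁ (proj₂ (avoid n (put (state z n) (z n)) (ℕ.suc (length z n))))

  length-mono : ∀ z → m ≤′ n → length z m ≤ length z n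
  length-mono z ≤′-refl       = ≤-refl
  length-mono z (≤′-step m≤n) = ≤-trans (length-mono z m≤n) (<⇒≤ (length-< z _))

  point-stable : ∀ z → m ≤′ n → point z n ≈[ length z m ] point z m
  point-stable z ≤′-refl               = ≈-refl
  point-stable z (≤′-step {n = n} m≤n) = ≈-trans
    (≈-anti (length-mono z m≤n) (≈-trans
      (≈-anti (n≤1+n _) (point-step z n))
      (put-≈ _ _ (z n))))
    (point-stable z m≤n)

  -- The limit of the points: digit `j` is settled at stage `suc j`, whose length is at least
  -- `suc j`.
  embed : 2^ω → 2^ω
  embed z j = point z (ℕ.suc j) j

  embed-≈ : ∀ z n → embed z ≈[ length z n ] point z n
  embed-≈ z n j j<k with ≤-total n (ℕ.suc j)
  ... | inj₁ n≤ = point-stable z (≤⇒≤′ n≤) j j<k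
  ... | inj₂ ≤n = sym (point-stable z (≤⇒≤′ ≤n) j (n≤length z (ℕ.suc j)))

  embed-avoids : ∀ z n → ¬ N n (embed z)
  embed-avoids z n =
    let v , _ , l , ¬N = avoid n (put (state z n) (z n)) (ℕ.suc (length z n))
    in ¬N (embed z) (≈-anti (m≤n+m l _) (embed-≈ z (ℕ.suc n)))

  embed-reads : ∀ z n → embed z (length z n) ≡ z n
  embed-reads z n = trans
    (embed-≈ z (ℕ.suc n) _ (length-< z n))
    (trans (point-step z n _ (n<1+n _)) (put-at (point z n) (length z n) (z n)))

  -- Equal states write their next digits at the same position, where the two limits agree; hence
  -- these digits and the next states are equal.
  embed-injective : ∀ {y z} → embed y ≗ embed z → y ≗ z
  embed-injective {y} {z} eq n = digits n (states n)
    where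
    digits : ∀ n → state y n ≡ state z n → y n ≡ z n
    digits n same = trans (sym (embed-reads y n)) (trans (eq (length y n))
      (trans (cong (embed z ∘ proj₂) same) (embed-reads z n)))

    states : ∀ n → state y n ≡ state z n
    states zero      = refl
    states (ℕ.suc n) = cong₂ (step n) (states n) (digits n (states n))

-- Towers of subsets and minima of cardinals

module Classical (em : ∀ ℓ → ExcludedMiddle ℓ) where

  -- Excluded middle lowers any proposition to the lowest universe.
  Small : Set ℓ → Set
  Small {ℓ} P = True (em ℓ {P})

  small : {P : Set ℓ} → P → Small P
  small = fromWitness

  unsmall : {P : Set ℓ} → Small P → P
  unsmall = toWitness

  by-contradiction : {P : Set ℓ} → ¬ ¬ P → P
  by-contradiction {ℓ} = decidable-stable (em ℓ)

  ¬∀⟶∃¬ : {A : Set a} {P : A → Set ℓ} → ¬ (∀ u → P u) → ∃[ u ] ¬ P u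
  ¬∀⟶∃¬ ¬∀ = by-contradiction λ ¬∃ →
    ¬∀ λ u → by-contradiction λ ¬Pu → ¬∃ (u , ¬Pu)

  nonempty⇒∃ : {A : PointSet} → IsNonempty A → ∃ (proj₁ A)
  nonempty⇒∃ ne = by-contradiction λ ¬∃ → ne ((λ Au → ¬∃ (_ , Au)) , λ ())

  module Tower {X : Set x} (grow : Pred X 0ℓ → Pred X 0ℓ)
               (grow-⊇ : ∀ {S} → S ⊆ grow S)
               (grow-cong : ∀ {S T} → S ≐ T → grow S ⊆ grow T) where

    Union : Pred (Pred X 0ℓ) 0ℓ → Pred X 0ℓ
    Union C u = Small (∃[ S ] C S × S u)

    -- The transfinite iterates of `grow`, obtained without ordinals by closing under successors and
    -- unions.
    data Stage : Pred X 0ℓ → Set (suc 0ℓ ⊔ x) where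
      next  : ∀ {S} → Stage S → Stage (grow S)
      limit : ∀ C → (∀ {S} → C S → Stage S) → Stage (Union C)

    Union-⊇ : ∀ {C : Pred (Pred X 0ℓ) 0ℓ} {S : Pred X 0ℓ} → C S → S ⊆ Union C
    Union-⊇ CS Su = small (_ , CS , Su)

    Union-split : ∀ {C : Pred (Pred X 0ℓ) 0ℓ} {T V : Pred X 0ℓ} →
                  (∀ {S} → C S → S ⊆ T ⊎ V ⊆ S) →
                  Union C ⊆ T ⊎ V ⊆ Union C
    Union-split {C} {T} {V} split with em _ {∃[ S ] C S × V ⊆ S}
    ... | yes (_ , CS , V⊆S) = inj₂ (Union-⊇ {C} CS ∘ V⊆S)
    ... | no ¬∃              = inj₁ λ u∈ → let S , CS , Su = unsmall u∈ in below CS Su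
      where
      below : ∀ {S} → C S → S ⊆ T
      below CS with split CS
      ... | inj₁ S⊆T = S⊆T
      ... | inj₂ V⊆S = contradiction (_ , CS , λ {u} → V⊆S {u}) ¬∃

    Comparable : Pred X 0ℓ → Pred X 0ℓ → Set x
    Comparable S T = S ⊆ T ⊎ grow T ⊆ S

    -- The gap lemma of the Bourbaki-Witt argument, by induction on `T`: `grow T` can pass beyond
    -- `S` only if `T` already has the elements of `S`, and then `grow-cong` applies.
    next-comparable : ∀ {S} → (∀ {T} → Stage T → Comparable S T) →
                      ∀ {T} → Stage T → Comparable T S
    next-comparable cmp (limit C C⊆) =
      Union-split λ CT → next-comparable cmp (C⊆ CT)
    next-comparable cmp (next t) with next-comparable cmp t
    ... | inj₂ S⁺⊆T = inj₂ (grow-⊇ ∘ S⁺⊆T)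
    ... | inj₁ T⊆S with cmp t
    ...   | inj₁ S⊆T  = inj₂ (grow-cong (S⊆T , T⊆S))
    ...   | inj₂ T⁺⊆S = inj₁ T⁺⊆S

    comparable : ∀ {S T} → Stage S → Stage T → Comparable S T
    comparable (limit C C⊆) t = Union-split λ CS → comparable (C⊆ CS) t
    comparable (next s) t with next-comparable (comparable s) t
    ... | inj₂ S⁺⊆T = inj₁ S⁺⊆T
    ... | inj₁ T⊆S with comparable s t
    ...   | inj₁ S⊆T  = inj₂ (grow-cong (T⊆S , S⊆T))
    ...   | inj₂ T⁺⊆S = inj₂ (grow-⊇ ∘ T⁺⊆S)

    total : ∀ {S T} → Stage S → Stage T → S ⊆ T ⊎ T ⊆ S
    total s t with comparable s t
    ... | inj₁ S⊆T  = inj₁ S⊆T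
    ... | inj₂ T⁺⊆S = inj₂ (T⁺⊆S ∘ grow-⊇)

    -- Because `Small` brings `Stage` to the lowest universe, the union of all stages is again a
    -- stage, and `grow` cannot leave it.
    top : Pred X 0ℓ
    top = Union (Small ∘ Stage)

    top-stage : Stage top
    top-stage = limit (Small ∘ Stage) unsmall

    top-fixed : grow top ⊆ top
    top-fixed = Union-⊇ {C = Small ∘ Stage} (small (next top-stage))

  nowhereDense⇒avoidable : ∀ {N} → NowhereDense N → Avoidable N
  nowhereDense⇒avoidable nwd u k =
    let v , ¬1      = ¬∀⟶∃¬ λ dense → nwd u (k , dense)
        v≈u , ¬2    = ¬→ ¬1
        l , ¬meets  = ¬∀⟶∃¬ ¬2
    in v , v≈u , l , λ w w≈v Nw → ¬meets (w , w≈v , Nw)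
    where
    ¬→ : {P Q : Set} → ¬ (P → Q) → P × ¬ Q
    ¬→ ¬PQ = by-contradiction (λ ¬P → ¬PQ λ p → contradiction p ¬P) , λ q → ¬PQ λ _ → q

module ClassicalChoice
  (em : ∀ ℓ → ExcludedMiddle ℓ)
  (ac : ∀ a ℓ₁ b ℓ₂ r → AxiomOfChoice a ℓ₁ b ℓ₂ r)
  where

  open Classical em

  module Hönig {I : Set ι} (A : I → Setoid a ℓ) (i₀ : I) where

    private module A i = Setoid (A i)

    Selector : Set (ι ⊔ a)
    Selector = ∀ i → A.Carrier i

    _∼_ : Selector → Selector → Set (ι ⊔ ℓ)
    s ∼ t = ∀ i → A._≈_ i (s i) (t i)

    selectors : Setoid (ι ⊔ a) (ι ⊔ ℓ)
    selectors = record
      { Carrier       = Selector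
      ; _≈_           = _∼_
      ; isEquivalence = record
        { refl  = λ i → A.refl i
        ; sym   = λ p i → A.sym i (p i)
        ; trans = λ p q i → A.trans i (p i) (q i)
        }
      }

    Onto : Pred Selector 0ℓ → Set (ι ⊔ a ⊔ ℓ)
    Onto S = ∃[ i ] ∀ y → ∃[ s ] S s × A._≈_ i (s i) y

    Onto-mono : ∀ {S T} → S ⊆ T → Onto S → Onto T
    Onto-mono S⊆T (i , onto) = i , λ y →
      let s , Ss , s≈y = onto y in s , S⊆T Ss , s≈y

    Fresh : Pred Selector 0ℓ → Selector → Set (ι ⊔ a ⊔ ℓ)
    Fresh S s = ∀ t → S t → ∀ i → ¬ A._≈_ i (t i) (s i)

    ¬Onto⇒Fresh : ∀ {S} → ¬ Onto S → ∃ (Fresh S)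
    ¬Onto⇒Fresh {S} ¬onto = (λ i → proj₁ (missed i)) , λ t St i t≈ →
      proj₂ (missed i) (t , St , t≈)
      where
      missed : ∀ i → ∃[ y ] ¬ (∃[ s ] S s × A._≈_ i (s i) y)
      missed i = ¬∀⟶∃¬ λ onto → ¬onto (i , onto)

    nonOnto : Setoid (suc 0ℓ ⊔ ι ⊔ a ⊔ ℓ) (ι ⊔ a)
    nonOnto = On.setoid {B = ∃[ S ] ¬ Onto S}
      (Poset.Eq.setoid (⊆-poset Selector 0ℓ)) proj₁

    -- The selector built in `¬Onto⇒Fresh` may depend on how `S` is presented. Choice makes it
    -- depend on the elements of `S` only, as `grow-cong` requires.
    freshChoice : Σ[ f ∈ Func nonOnto selectors ]
                  (∀ S → Fresh (proj₁ S) (Func.to f S))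
    freshChoice = ac _ _ _ _ _ nonOnto selectors (Fresh ∘ proj₁)
      (λ (_ , S′⊆S) s∼s′ fresh t S′t i t≈s′ →
        fresh t (S′⊆S S′t) i (A.trans i t≈s′ (A.sym i (s∼s′ i))))
      (¬Onto⇒Fresh ∘ proj₂)

    open Func (proj₁ freshChoice) renaming (to to new; cong to new-cong)

    grow : Pred Selector 0ℓ → Pred Selector 0ℓ
    grow S s = Small (S s ⊎ (Σ[ ¬onto ∈ ¬ Onto S ] s ∼ new (S , ¬onto)))

    new∈grow : ∀ {S} (¬onto : ¬ Onto S) → grow S (new (S , ¬onto))
    new∈grow {S} ¬onto =
      small (inj₂ (¬onto , Setoid.refl selectors {new (S , ¬onto)}))

    grow-cong : ∀ {S T} → S ≐ T → grow S ⊆ grow T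
    grow-cong {S} {T} S≐T@(S⊆T , T⊆S) u∈ with unsmall u∈
    ... | inj₁ Su            = small (inj₁ (S⊆T Su))
    ... | inj₂ (¬onto , u∼) = small (inj₂ (¬onto′ , λ i → A.trans i (u∼ i) (new-cong S≐T i)))
      where
      ¬onto′ : ¬ Onto T
      ¬onto′ = ¬onto ∘ Onto-mono T⊆S

    open Tower grow (small ∘ inj₁) grow-cong

    Injective : Pred Selector 0ℓ → Set (ι ⊔ a ⊔ ℓ)
    Injective S = ∀ {s t} → S s → S t → ∀ i → A._≈_ i (s i) (t i) → s ∼ t

    -- A selector added by `grow` differs from all earlier ones in every coordinate, and any two
    -- selectors of a union lie in a common stage of the chain.
    stage-injective : ∀ {S} → Stage S → Injective S
    stage-injective (next {S} stage) s∈ t∈ i s≈t with unsmall s∈ | unsmall t∈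
    ... | inj₁ Ss            | inj₁ St            = stage-injective stage Ss St i s≈t
    ... | inj₁ Ss            | inj₂ (¬onto , t∼) = contradiction
      (A.trans i s≈t (t∼ i)) (proj₂ freshChoice (S , ¬onto) _ Ss i)
    ... | inj₂ (¬onto , s∼) | inj₁ St            = contradiction
      (A.trans i (A.sym i s≈t) (s∼ i)) (proj₂ freshChoice (S , ¬onto) _ St i)
    ... | inj₂ (_ , s∼)     | inj₂ (_ , t∼)     =
      λ j → A.trans j (s∼ j) (A.trans j (new-cong (id , id) j) (A.sym j (t∼ j)))
    stage-injective (limit C C⊆) s∈ t∈ i s≈t with unsmall s∈ | unsmall t∈
    ... | _ , CS , Ss | _ , CT , Tt with total (C⊆ CS) (C⊆ CT)
    ...   | inj₁ S⊆T = stage-injective (C⊆ CT) (S⊆T Ss) Tt i s≈t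
    ...   | inj₂ T⊆S = stage-injective (C⊆ CS) Ss (T⊆S Tt) i s≈t

    top-onto : Onto top
    top-onto = by-contradiction λ ¬onto →
      -- The new selector would lie in `top` and be fresh for it, so differ from itself at `i₀`.
      proj₂ freshChoice (top , ¬onto) _
        (top-fixed (new∈grow ¬onto)) i₀ (A.refl i₀)

    -- A point of `A i` is sent to the `j`-coordinate of a selector in `top` through it; the
    -- projections of `top` are injective.
    minimum : ∃[ i ] ∀ j → Injection (A i) (A j)
    minimum = i , λ j → record
      { to        = λ y → proj₁ (onto y) j
      ; cong      = λ {y} {z} y≈z → injective (selected y) (selected z) i
          (A.trans i (reaches y) (A.trans i y≈z (A.sym i (reaches z)))) j
      ; injective = λ {y} {z} eq → A.trans i (A.sym i (reaches y))
          (A.trans i (injective (selected y) (selected z) j eq i) (reaches z))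
      }
      where
      i    = proj₁ top-onto
      onto = proj₂ top-onto
      injective : Injective top
      injective = stage-injective top-stage
      selected : ∀ y → top (proj₁ (onto y))
      selected y = proj₁ (proj₂ (onto y))
      reaches : ∀ y → A._≈_ i (proj₁ (onto y) i) y
      reaches y = proj₂ (proj₂ (onto y))

  -- Codes for meager sets

  -- The closed set left when the balls listed by `c` under index `n` are removed; digit `j` of `c`
  -- decides about the pair `unpair j`.
  InComplement : 2^ω → ℕ → Pred 2^ω 0ℓ
  InComplement c n u =
    ∀ j → proj₁ (unpair j) ≡ n → c j ≡ true → ¬ Ball (proj₂ (unpair j)) u

  -- The first conjunct makes layers that are not nowhere dense code the empty set.
  Layer : 2^ω → ℕ → Pred 2^ω 0ℓ
  Layer c n u = NowhereDense (InComplement c n) × InComplement c n u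

  Coded : 2^ω → Pred 2^ω 0ℓ
  Coded c = ⋃[ n ∶ ℕ ] Layer c n

  InComplement-resp : ∀ c n → InComplement c n Respects _≗_
  InComplement-resp c n u≗v out j eq on v∈ = out j eq on (≈-trans (≗⇒≈ u≗v) v∈)

  layer : 2^ω → ℕ → PointSet
  layer c n = Layer c n , λ u≗v (nwd , out) → nwd , InComplement-resp c n u≗v out

  coded : 2^ω → PointSet
  coded c = Coded c , λ u≗v (n , u∈) → n , proj₂ (layer c n) u≗v u∈

  Layer-nowhereDense : ∀ c n → NowhereDense (Layer c n)
  Layer-nowhereDense c n u (k , dense) =
    -- A layer that is dense somewhere has a point, and with it a proof of the first conjunct.
    let _ , _ , nwd , _ = dense u ≈-refl 0
    in nowhereDense-⊆ proj₂ nwd u (k , dense)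

  coded-meager : ∀ c → IsMeager (coded c)
  coded-meager c = layer c , Layer-nowhereDense c , id , id

  Coded-cong : ∀ {c d} → c ≗ d → Coded c ⊆ Coded d
  Coded-cong {c} {d} c≗d (n , nwd , out) =
    n , nowhereDense-⊆ (transfer (≗-sym c≗d)) nwd , transfer c≗d out
    where
    transfer : ∀ {c d} → c ≗ d → InComplement c n ⊆ InComplement d n
    transfer c≗d out j eq on = out j eq (trans (c≗d j) on)

  -- The code lists every ball that misses `N n`, so `InComplement c n` is the closure of `N n`.
  coded-cofinal : {A : PointSet} → IsMeager A → ∃[ c ] proj₁ A ⊆ Coded c
  coded-cofinal (N , nwd , A⊆N , _) = c , λ Au →
    let n , Nu = A⊆N Au in n , avoidable⇒nowhereDense (code-avoidable n) , N⊆ n Nu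
    where
    Misses : ℕ × ℕ → Set
    Misses (n , m) = ∀ w → Ball m w → ¬ proj₁ (N n) w

    c : 2^ω
    c j = does (em 0ℓ {Misses (unpair j)})

    N⊆ : ∀ n → proj₁ (N n) ⊆ InComplement c n
    N⊆ n Nu j refl on u∈ with em 0ℓ {Misses (unpair j)}
    ... | yes misses = misses _ u∈ Nu
    N⊆ n Nu j refl () u∈ | no _

    code-avoidable : ∀ n → Avoidable (InComplement c n)
    code-avoidable n u k =
      let v , v≈u , l , ¬N = nowhereDense⇒avoidable (nwd n) u k
          m , r≡l , m≈v    = ball v l
          j , e            = unpair-surjective n m
          misses           = λ w w∈ → ¬N w
            (≈-trans (subst (λ r → w ≈[ r ] centre m) r≡l w∈) m≈v)
      in v , v≈u , l , λ w w≈v out →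
        out j (cong proj₁ e) (dec-true (em 0ℓ) (subst Misses (sym e) misses))
          (subst (λ p → Ball (proj₂ p) w) (sym e)
            (subst (λ r → w ≈[ r ] centre m) (sym r≡l) (≈-trans w≈v (≈-sym m≈v))))

  -- Kuratowski–Ulam

  Star : (Y A : Pred 2^ω 0ℓ) → Pred 2^ω 0ℓ
  Star Y A u = ∀ v → Y v → A (u ⊕ v)

  star : (Y A : PointSet) → PointSet
  star (Y , _) (A , A-resp) = Star Y A , λ u≗u′ u∈ v Yv →
    A-resp (⊕-cong u≗u′ (λ _ → refl)) (u∈ v Yv)

  -- For `u` in the star, the sections at `u` of the sets `N n` cover `Y`. As `Y` is not meager, one
  -- of them is dense in a ball of the base, which puts `u` into some `D j`.
  star-meager : ∀ Y A → ¬ IsMeager Y → IsMeager A → IsMeager (star Y A)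
  star-meager Y A ¬meagerY (N , nwd , A⊆N , _) =
    coveredMeager (star Y A) D D-nowhereDense covered
    where
    D : ℕ → PointSet
    D j = let n , m = unpair j in
      DenseSection (proj₁ (N n)) m , λ u≗u′ dense v v∈ l →
        let w , w≈v , Nw = dense v v∈ l
        in w , w≈v , proj₂ (N n) (⊕-cong u≗u′ (λ _ → refl)) Nw

    D-nowhereDense : ∀ j → NowhereDense (proj₁ (D j))
    D-nowhereDense j = let n , m = unpair j in avoidable⇒nowhereDense
      (denseSection-avoidable m (nowhereDense⇒avoidable (nwd n)))

    covered : Star (proj₁ Y) (proj₁ A) ⊆ ⋃[ j ∶ ℕ ] proj₁ (D j)
    covered {u} u∈ =
      let n , ¬nwd      = ¬∀⟶∃¬ λ sections-nwd → ¬meagerY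
            (coveredMeager Y section sections-nwd λ Yv → A⊆N (u∈ _ Yv))
          v , ¬empty    = ¬∀⟶∃¬ ¬nwd
          k , dense     = by-contradiction ¬empty
          m , r≡k , m≈v = ball v k
          j , e         = unpair-surjective n m
      in j , subst (λ p → DenseSection (proj₁ (N (proj₁ p))) (proj₂ p) u) (sym e)
               λ w w∈ → dense w (≈-trans (subst (λ r → w ≈[ r ] centre m) r≡k w∈) m≈v)
      where
      section : ℕ → PointSet
      section n = (λ v → proj₁ (N n) (u ⊕ v)) ,
                  λ v≗v′ → proj₂ (N n) (⊕-cong (λ _ → refl) v≗v′)

  -- Comparable and cofinal families

  module _ {c ℓ₁ ℓ₂} (P : Poset c ℓ₁ ℓ₂) (F : Family P) where
    open Poset P renaming (_≤_ to _≤ᴾ_)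

    private module F = Setoid (∣_∣ P F)

    -- Choice picks for every image point a member of `F` related to it; single-valuedness of `R`
    -- keeps the picks apart. `R` may be partial.
    cofinalImage : (R : REL F.Carrier Carrier 0ℓ) →
      (∀ {p q x y} → p F.≈ q → x ≈ y → R p x → R q y) →
      (∀ {q x y} → R q x → R q y → x ≈ y) →
      (∀ x → ∃₂ λ q y → R q y × x ≤ᴾ y) →
      ∃[ G ] IsCofinal P G × Injection (∣_∣ P G) (∣_∣ P F)
    cofinalImage R ext single cofinal =
      G ,
      (λ x → let q , y , Rqy , x≤y = cofinal x in y , (q , Rqy) , x≤y) ,
      record
        { to        = to
        ; cong      = λ {x} {y} → to-cong {x} {y}
        ; injective = λ {x} {y} eq → single (ext eq Eq.refl (chosen x)) (chosen y)
        }
      where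
      G : Family P
      G y = ∃[ q ] R q y
      choice = ac _ _ _ _ _ (∣_∣ P G) (∣_∣ P F) (λ y q → R q (proj₁ y))
        (λ x≈y p≈q → ext p≈q x≈y) proj₂
      open Func (proj₁ choice) renaming (cong to to-cong)
      chosen = proj₂ choice

  ⟦_⟧ : Poset.Carrier meager∖∅ → Pred 2^ω 0ℓ
  ⟦ A ⟧ = proj₁ (proj₁ A)

  nonempty-⊆ : {A B : PointSet} → proj₁ A ⊆ proj₁ B → IsNonempty A → IsNonempty B
  nonempty-⊆ A⊆B ne (B⊆∅ , _) = ne (B⊆∅ ∘ A⊆B , λ ())

  comparable⇒cofinal : ∀ F → IsComparable meager∖∅ F →
    ∃[ G ] IsCofinal meager∖∅ G × Injection (∣_∣ meager∖∅ G) (∣_∣ meager∖∅ F)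
  comparable⇒cofinal F comparable = bySize (em _)
    where
    module F = Setoid (∣_∣ meager∖∅ F)

    pointChoice : Σ[ f ∈ Func (∣_∣ meager∖∅ F) (ℕ →-setoid Bool) ]
                  (∀ q → ⟦ proj₁ q ⟧ (Func.to f q))
    pointChoice = ac _ _ _ _ _ (∣_∣ meager∖∅ F) (ℕ →-setoid Bool)
      (λ q u → ⟦ proj₁ q ⟧ u)
      (λ {q} {q′} q≐q′ u≗v u∈q → proj₂ (proj₁ (proj₁ q′)) u≗v (proj₁ q≐q′ u∈q))
      (λ ((A , _ , ne) , _) → nonempty⇒∃ {A} ne)

    open Func (proj₁ pointChoice) renaming (to to pt; cong to pt-cong)

    Hit : Pred 2^ω (suc 0ℓ)
    Hit v = ∃[ q ] odds (pt q) ≗ v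

    Y : PointSet
    Y = (λ v → Small (¬ Hit v)) , λ u≗v ¬hit → small λ (q , q≗v) →
      unsmall ¬hit (q , λ j → trans (q≗v j) (sym (u≗v j)))

    starFamily : ¬ IsMeager Y →
      ∃[ G ] IsCofinal meager∖∅ G × Injection (∣_∣ meager∖∅ G) (∣_∣ meager∖∅ F)
    starFamily ¬meagerY = cofinalImage meager∖∅ F
      -- A relation and not a function, since q* may be empty and then falls outside `meager∖∅`.
      (λ q B → ⟦ B ⟧ ≐ Star (proj₁ Y) ⟦ proj₁ q ⟧)
      (λ (p⊆q , q⊆p) (A⊆B , B⊆A) (A⊆ , ⊆A) →
        (λ Bu v Yv → p⊆q (A⊆ (B⊆A Bu) v Yv)) ,
        (λ u∈ → A⊆B (⊆A λ v Yv → q⊆p (u∈ v Yv))))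
      (λ (A⊆ , ⊆A) (B⊆ , ⊆B) → (λ u∈ → ⊆B (A⊆ u∈)) , (λ u∈ → ⊆A (B⊆ u∈)))
      cofinal
      where
      cofinal : ∀ A → ∃₂ λ q B → (⟦ B ⟧ ≐ Star (proj₁ Y) ⟦ proj₁ q ⟧) × ⟦ A ⟧ ⊆ ⟦ B ⟧
      cofinal (A@(_ , A-resp) , mA@(N , nwd , A⊆N , _) , ne) =
        below (comparable (A×Y , A×Y-meager , A×Y-nonempty))
        where
        A×Y : PointSet
        A×Y = (λ w → proj₁ A (evens w) × proj₁ Y (odds w)) , λ w≗w′ (Aw , Yw) →
          A-resp (λ j → w≗w′ _) Aw , proj₂ Y (λ j → w≗w′ _) Yw

        A×Y-meager : IsMeager A×Y
        A×Y-meager = coveredMeager A×Y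
          (λ n → proj₁ (N n) ∘ evens , λ w≗w′ → proj₂ (N n) (λ j → w≗w′ _))
          (λ n → avoidable⇒nowhereDense
            (evens⁻¹-avoidable (nowhereDense⇒avoidable (nwd n))))
          (A⊆N ∘ proj₁)

        pair : ∀ {u v} → proj₁ A u → proj₁ Y v → proj₁ A×Y (u ⊕ v)
        pair {u} {v} Au Yv =
          A-resp (≗-sym (evens-⊕ u v)) Au , proj₂ Y (≗-sym (odds-⊕ u v)) Yv

        A×Y-nonempty : IsNonempty A×Y
        A×Y-nonempty (A×Y⊆∅ , _) =
          let u , Au = nonempty⇒∃ {A} ne in
          -- With no points in the product, `Y` would be empty and covered by any nowhere dense
          -- sets, such as those of `A`.
          ¬meagerY (coveredMeager Y N nwd λ {v} Yv →
            contradiction (pair Au Yv) (A×Y⊆∅ {u ⊕ v}))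

        below : (∃[ q ] F q × (proj₁ A×Y ⊆ ⟦ q ⟧ ⊎ ⟦ q ⟧ ⊆ proj₁ A×Y)) →
          ∃₂ λ q B → (⟦ B ⟧ ≐ Star (proj₁ Y) ⟦ proj₁ q ⟧) × proj₁ A ⊆ ⟦ B ⟧
        below (q@(Q , mQ , _) , Fq , inj₁ A×Y⊆q) =
          (q , Fq) ,
          (star Y Q , star-meager Y Q ¬meagerY mQ , nonempty-⊆ {A} {star Y Q} A⊆q* ne) ,
          (id , id) , A⊆q*
          where
          A⊆q* : proj₁ A ⊆ Star (proj₁ Y) ⟦ q ⟧
          A⊆q* Au v Yv = A×Y⊆q (pair Au Yv)
        below (q , Fq , inj₂ q⊆A×Y) = contradiction
          ((q , Fq) , λ _ → refl)
          (unsmall (proj₂ (q⊆A×Y (proj₂ pointChoice (q , Fq)))))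

    -- The points `embed z` lie outside `Y`, so each is the second coordinate of a chosen point,
    -- whose member of `F` stands for the code `z`; injectivity of `embed` makes this code unique.
    codedFamily : IsMeager Y →
      ∃[ G ] IsCofinal meager∖∅ G × Injection (∣_∣ meager∖∅ G) (∣_∣ meager∖∅ F)
    codedFamily (N , nwd , Y⊆N , N⊆Y) = cofinalImage meager∖∅ F
      (λ q B → ∃[ z ] odds (pt q) ≗ embed z × ⟦ B ⟧ ≐ Coded z)
      (λ {p} {q} p≐q (A⊆B , B⊆A) (z , p≗ , A⊆ , ⊆A) →
        z , (λ j → trans (sym (pt-cong {p} {q} p≐q _)) (p≗ j)) ,
        A⊆ ∘ B⊆A , A⊆B ∘ ⊆A)
      (λ (y , q≗y , A⊆ , ⊆A) (z , q≗z , B⊆ , ⊆B) →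
        let y≗z = embed-injective λ j → trans (sym (q≗y j)) (q≗z j) in
        (λ u∈ → ⊆B (Coded-cong y≗z (A⊆ u∈))) ,
        (λ u∈ → ⊆A (Coded-cong (≗-sym y≗z) (B⊆ u∈))))
      λ (A , mA , ne) →
        let z , A⊆z = coded-cofinal {A} mA
            q , q≗z = hit z
        in q , (coded z , coded-meager z , nonempty-⊆ {A} {coded z} A⊆z ne) ,
           (z , q≗z , id , id) , A⊆z
      where
      open Fusion (proj₁ ∘ N) (nowhereDense⇒avoidable ∘ nwd)

      hit : ∀ z → Hit (embed z)
      hit z = by-contradiction λ ¬hit →
        let n , Nz = Y⊆N (small ¬hit) in embed-avoids z n Nz

    bySize : Dec (IsMeager Y) →
      ∃[ G ] IsCofinal meager∖∅ G × Injection (∣_∣ meager∖∅ G) (∣_∣ meager∖∅ F)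
    bySize (yes meagerY)  = codedFamily meagerY
    bySize (no ¬meagerY) = starFamily ¬meagerY

  -- A least cofinal family, and the passage between `meager∖∅` and `meager`

  leastCofinal : ∃[ G ] IsCofinal meager∖∅ G ×
    (∀ F → IsCofinal meager∖∅ F → Injection (∣_∣ meager∖∅ G) (∣_∣ meager∖∅ F))
  leastCofinal =
    let (G , cofinal) , least = Hönig.minimum
          {I = ∃ (IsCofinal meager∖∅)} (∣_∣ meager∖∅ ∘ proj₁)
          ((λ _ → Lift _ ⊤) , λ A → A , _ , id)
    in G , cofinal , λ F cofinalF → least (F , cofinalF)

  module Meager (G : Family meager∖∅) (cofinal : IsCofinal meager∖∅ G) where

    G⁺ : Family meager
    G⁺ (A , mA) = Σ[ ne ∈ IsNonempty A ] G (A , mA , ne)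

    G⁺-cofinal : IsCofinal meager G⁺
    G⁺-cofinal (A , mA) with em _ {IsNonempty A}
    ... | yes ne = let (B , mB , ne′) , GB , A⊆B = cofinal (A , mA , ne)
                   in (B , mB) , (ne′ , GB) , A⊆B
    ... | no empty =
      -- The empty set lies below any member of `G⁺`; one is found above a singleton.
      let o                     = λ _ → false
          (B , mB , ne) , GB , _ = cofinal (singleton o , singleton-meager o ,
            λ (o∉ , _) → o∉ {o} λ _ → refl)
      in (B , mB) , (ne , GB) , λ Au →
        contradiction (λ (A⊆∅ , _) → A⊆∅ Au) empty

    G≅G⁺ : Bijection (∣_∣ meager∖∅ G) (∣_∣ meager G⁺)
    G≅G⁺ = record
      { to        = λ ((A , mA , ne) , GA) → (A , mA) , ne , GA
      ; cong      = id
      ; bijective = id , λ ((A , mA) , ne , GA) → ((A , mA , ne) , GA) , id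
      }

  nonemptyMembers : (F : Family meager) → IsCofinal meager F →
    ∃[ G ] IsCofinal meager∖∅ G × Injection (∣_∣ meager∖∅ G) (∣_∣ meager F)
  nonemptyMembers F cofinal =
    (λ (A , mA , _) → F (A , mA)) ,
    (λ (A , mA , ne) → let (B , mB) , FB , A⊆B = cofinal (A , mA)
                       in (B , mB , nonempty-⊆ {A} {B} A⊆B ne) , FB , A⊆B) ,
    record
      { to        = λ ((A , mA , _) , FA) → (A , mA) , FA
      ; cong      = id
      ; injective = id
      }

mainTheorem14 : (∀ ℓ → ExcludedMiddle ℓ) →
    (∀ a ℓ₁ b ℓ₂ r → AxiomOfChoice a ℓ₁ b ℓ₂ r) →
    Σ[ κ ∈ Setoid (suc 0ℓ) 0ℓ ] (Is-𝔠𝔭 meager∖∅ κ × Is-cof meager κ)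
mainTheorem14 em ac =
  let open ClassicalChoice em ac
      G , cofinal , least = leastCofinal
      open Meager G cofinal
  in
  ∣_∣ meager∖∅ G ,
  ( (G , (λ A → let B , GB , A⊆B = cofinal A in B , GB , inj₁ A⊆B) ,
      Identity.bijection _) ,
    λ F comparable → let H , cofinalH , H↣F = comparable⇒cofinal F comparable
                     in Composition.injection (least H cofinalH) H↣F ) ,
  ( (G⁺ , G⁺-cofinal , G≅G⁺) ,
    λ F cofinalF → let H , cofinalH , H↣F = nonemptyMembers F cofinalF
                   in Composition.injection (least H cofinalH) H↣F )
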